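{- Let $n\ge1$ and $I\subset[n-1]$, written as a disjoint union of maximal intervals $I=\bigcup_{1\le t\le k}\{u_t,u_t+1,\ldots,v_t\}$ with $u_t\le v_t$ and $v_t+1\le u_{t+1}-1$. For $A,B\in\mathrm{ASM}^I(n)$, the join of $A$ and $B$ in $\mathrm{ASM}^I(n)$ agrees with their join in $\mathrm{ASM}(n)$, while the meet of $A$ and $B$ in $\mathrm{ASM}^I(n)$, denoted by $C$, is given by: for all $j\in[n]$, \[r_C(i,j)=\begin{cases}\max\{r_A(i,j),r_B(i,j)\}, & i\in[n]\setminus I,\\ \min\{r_C(v_t+1,j),\ r_C(u_t-1,j)+(i-u_t+1)\}, & u_t\le i\le v_t,\ t\in[k].\end{cases}\]
   Context: $[m]=\{1,\dots,m\}$. An alternating sign matrix (ASM) is a square matrix with entries in $\{0,1,-1\}$ such that the nonzero entries in each row and each column alternate in sign and each row and each column sums to $1$; $\mathrm{ASM}(n)$ is the set of $n\times n$ ASMs. The rank matrix of $A$ is $r_A(i,j)=\sum_{p=1}^i\sum_{q=1}^jA_{p,q}$, with $r_A(0,j)=r_A(i,0)=0$; it determines $A$. Order on $\mathrm{ASM}(n)$: $A\le B$ iff $r_A(i,j)\ge r_B(i,j)$ for all $i,j\in[n]$; this makes $\mathrm{ASM}(n)$ a lattice, with join (resp. meet) given by entrywise minimum (resp. maximum) of rank matrices. $\mathrm{ASM}^I(n):=\{A\in\mathrm{ASM}(n)\mid r_A(i,j)\in\{r_A(i-1,j)+1,\ r_A(i+1,j)\}\text{ for all }i\in I,\ j\in[n]\}$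 with the induced order. -}

module Defs where

open import Algebra.Properties.CommutativeMonoid.Sum using (sum)
open import Data.Bool.Base using (if_then_else_)
open import Data.Fin.Base as Fin using (Fin; toℕ)
open import Data.Fin.Subset using (Subset; _∈_)
open import Data.Integer.Base as ℤ using (ℤ; +_; 0ℤ; 1ℤ; -1ℤ; sign; _⊔_; _⊓_)
open import Data.Integer.Properties using (+-0-commutativeMonoid)
open import Data.Nat.Base as ℕ using (ℕ; suc; _∸_; _≤_)
open import Data.Nat.Properties using (_<?_)
open import Data.Product.Base using (Σ; ∃; _×_; proj₁)
open import Data.Sign.Base using (opposite)
open import Data.Sum.Base using (_⊎_)
open import Data.Vec.Functional using (Vector)
open import Function.Base using (_on_; flip)
open import Function.Bundles using (_⇔_)
open import Relation.Binary.Core using (Rel)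
open import Relation.Binary.PropositionalEquality.Core using (_≡_; _≢_)
open import Relation.Nullary.Decidable using (⌊_⌋)
open import Relation.Nullary.Negation using (¬_)
import Level

∑ : ∀ {n} → Vector ℤ n → ℤ
∑ = sum +-0-commutativeMonoid

infix 4 _∈[_]
_∈[_] : ℕ → ℕ → Set
i ∈[ n ] = 1 ≤ i × i ≤ n

-- Rows and columns are numbered from 0 by Fin n and from 1 elsewhere:
-- p : Fin n stands for the row (or column) suc (toℕ p).
Matrix : ℕ → Set
Matrix n = Vector (Vector ℤ n) n

-- Consecutive nonzero entries have opposite signs.
Alternating : ∀ {n} → Vector ℤ n → Set
Alternating {n} x = (p q : Fin n) → p Fin.< q → x p ≢ 0ℤ → x q ≢ 0ℤ →
  (∀ s → p Fin.< s → s Fin.< q → x s ≡ 0ℤ) →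
  sign (x q) ≡ opposite (sign (x p))

record IsASM {n : ℕ} (M : Matrix n) : Set where
  field
    entries         : ∀ p q → M p q ≡ 0ℤ ⊎ M p q ≡ 1ℤ ⊎ M p q ≡ -1ℤ
    row-alternating : ∀ p → Alternating (λ q → M p q)
    col-alternating : ∀ q → Alternating (λ p → M p q)
    row-sum         : ∀ p → ∑ (λ q → M p q) ≡ 1ℤ
    col-sum         : ∀ q → ∑ (λ p → M p q) ≡ 1ℤ

ASM : ℕ → Set
ASM n = Σ (Matrix n) IsASM

-- The sum of the first i entries of x (of all of them if i exceeds n).
partialSum : ∀ {n} → ℕ → Vector ℤ n → ℤ
partialSum i x = ∑ (λ p → if ⌊ toℕ p <? i ⌋ then x p else 0ℤ)

r : ∀ {n} → ASM n → ℕ → ℕ → ℤ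
r A i j = partialSum i (λ p → partialSum j (λ q → proj₁ A p q))

infix 4 _≤ᴬ_
_≤ᴬ_ : ∀ {n} → Rel (ASM n) Level.zero
_≤ᴬ_ {n} A B = ∀ i j → i ∈[ n ] → j ∈[ n ] → r A i j ℤ.≥ r B i j

-- A subset of [n-1] is a Subset (n ∸ 1), whose elements are again
-- numbered from 0; i ∈ᴵ I is membership of the 1-based number i.
infix 4 _∈ᴵ_ _∉ᴵ_
_∈ᴵ_ _∉ᴵ_ : ∀ {m} → ℕ → Subset m → Set
i ∈ᴵ I = ∃ λ p → suc (toℕ p) ≡ i × p ∈ I
i ∉ᴵ I = ¬ (i ∈ᴵ I)

ASMᴵ : (n : ℕ) → Subset (n ∸ 1) → Set
ASMᴵ n I = Σ (ASM n) λ A → ∀ i j → i ∈ᴵ I → j ∈[ n ] →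
  r A i j ≡ r A (i ∸ 1) j ℤ.+ 1ℤ ⊎ r A i j ≡ r A (suc i) j

infix 4 _≤ᴵ_
_≤ᴵ_ : ∀ {n} {I : Subset (n ∸ 1)} → Rel (ASMᴵ n I) Level.zero
_≤ᴵ_ = _≤ᴬ_ on proj₁

-- Pointwise forms of Supremum and Infimum from Relation.Binary.Lattice.
IsJoin IsMeet : ∀ {X : Set} → Rel X Level.zero → X → X → X → Set
IsJoin _⊑_ x y s = x ⊑ s × y ⊑ s × (∀ z → x ⊑ z → y ⊑ z → s ⊑ z)
IsMeet _⊑_ = IsJoin (flip _⊑_)

-- I is the disjoint union of its maximal intervals {u t, …, v t},
-- listed in increasing order; the gap condition makes them maximal.
record IsIntervalDecomposition {m k : ℕ} (I : Subset m) (u v : Fin k → ℕ) : Set where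
  field
    union    : ∀ i → i ∈ᴵ I ⇔ (∃ λ t → u t ≤ i × i ≤ v t)
    nonempty : ∀ t → u t ≤ v t
    gap      : ∀ s t → toℕ t ≡ suc (toℕ s) → suc (v s) ≤ u t ∸ 1

record MeetFormula {n k : ℕ} (I : Subset (n ∸ 1)) (u v : Fin k → ℕ)
                   (A B C : ASM n) : Set where
  field
    outside : ∀ i j → i ∈[ n ] → i ∉ᴵ I → j ∈[ n ] →
      r C i j ≡ r A i j ⊔ r B i j
    inside  : ∀ t i j → u t ≤ i → i ≤ v t → j ∈[ n ] →
      r C i j ≡ r C (suc (v t)) j ⊓ (r C (u t ∸ 1) j ℤ.+ (+ i ℤ.- + u t ℤ.+ 1ℤ))

{-# OPTIONS --safe #-}

-- Rank matrices are exactly the integer arrays with unit steps in both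
-- directions and the boundary values r(0,j) = r(i,0) = 0, r(n,j) = j,
-- r(i,n) = i.  Along a column, the condition defining ASMᴵ says that the steps
-- are nonincreasing across every row i ∈ I, i.e. that the rank function is
-- concave there.  Concavity is preserved by minima, whence the joins.  For the
-- meets, the least concave function above M = max(r_A, r_B) is the minimum of
-- two bounds: the value of M at the next row outside I, and the value of M at
-- the previous such row continued with slope 1.
module Submission where

open import Defs
import Data.Integer.Properties as ℤₚ
open import Algebra.Bundles using (CommutativeMonoid)
open import Algebra.Properties.Monoid.Sum
  (CommutativeMonoid.monoid ℤₚ.+-0-commutativeMonoid) using (sum-cong-≗)
open import Data.Bool.Base using (if_then_else_)
open import Data.Fin.Base as Fin using (Fin; zero; suc; toℕ; fromℕ<)
open import Data.Fin.Properties using (any?; toℕ<n; toℕ-fromℕ<; toℕ-injective)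
open import Data.Fin.Subset using (Subset)
open import Data.Fin.Subset.Properties using (_∈?_)
open import Data.Integer.Base using (ℤ; +_; 0ℤ; 1ℤ; -1ℤ; _+_; _-_; _⊓_; _⊔_; sign; +≤+)
  renaming (_≤_ to _≤ᶻ_)
import Data.Integer.Base as ℤ
open import Data.Integer.Tactic.RingSolver using (solve-∀)
open import Data.Nat.Base as ℕ using (ℕ; zero; suc; _∸_; _≤_; _<_; z≤n; s≤s)
import Data.Nat.Properties as ℕₚ
open import Data.Product.Base using (∃; _×_; _,_; proj₁; proj₂)
open import Data.Sign.Base using (opposite)
open import Data.Sum.Base as Sum using (_⊎_; inj₁; inj₂; [_,_]′)
open import Data.Vec.Functional using (Vector; tail)
open import Function.Base using (_∘_)
open import Function.Bundles using (Equivalence)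
open import Relation.Binary.Definitions using (tri<; tri≈; tri>)
open import Relation.Binary.PropositionalEquality
open import Relation.Nullary using (¬_; Dec; yes; no; does; contradiction)
open import Relation.Nullary.Decidable using (_×-dec_; isYes≗does)
open import Relation.Unary using (Decidable)

private
  variable
    m n : ℕ

-- Unit steps

Bit : ℤ → Set
Bit z = z ≡ 0ℤ ⊎ z ≡ 1ℤ

Step : ℤ → ℤ → Set
Step x y = x ≤ᶻ y × y ≤ᶻ x + 1ℤ

x≤x+1 : ∀ x → x ≤ᶻ x + 1ℤ
x≤x+1 x = ℤₚ.i≤i+j x 1ℤ

Step-refl : ∀ {x} → Step x x
Step-refl = ℤₚ.≤-refl , x≤x+1 _

Step-reflexive : ∀ {x y} → x ≡ y → Step x y
Step-reflexive refl = Step-refl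

Step-+-Bit : ∀ x {b} → Bit b → Step x (x + b)
Step-+-Bit x (inj₁ refl) = Step-reflexive (sym (ℤₚ.+-identityʳ x))
Step-+-Bit x (inj₂ refl) = x≤x+1 x , ℤₚ.≤-refl

Bit-difference : ∀ {x y} → Step x y → Bit (y - x)
Bit-difference {x} {y} (x≤y , y≤x+1) = bit (y - x) (ℤₚ.i≤j⇒0≤j-i x≤y)
  (subst (y - x ≤ᶻ_) (cancel x) (ℤₚ.+-monoˡ-≤ (ℤ.- x) y≤x+1))
  where
  cancel : ∀ x → (x + 1ℤ) - x ≡ 1ℤ
  cancel = solve-∀

  bit : ∀ z → 0ℤ ≤ᶻ z → z ≤ᶻ 1ℤ → Bit z
  bit (+ 0) _ _ = inj₁ refl
  bit (+ 1) _ _ = inj₂ refl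
  bit (+ suc (suc _)) _ (+≤+ (s≤s ()))

Step-+ˡ : ∀ c {x y} → Step x y → Step (c + x) (c + y)
Step-+ˡ c {x} {y} (x≤y , y≤x+1) =
  ℤₚ.+-monoʳ-≤ c x≤y ,
  subst (c + y ≤ᶻ_) (sym (ℤₚ.+-assoc c x 1ℤ)) (ℤₚ.+-monoʳ-≤ c y≤x+1)

Step-+1 : ∀ {x y} → Step x y → Step (x + 1ℤ) (y + 1ℤ)
Step-+1 (x≤y , y≤x+1) = ℤₚ.+-monoˡ-≤ 1ℤ x≤y , ℤₚ.+-monoˡ-≤ 1ℤ y≤x+1

Step-⊓ : ∀ {w x y z} → Step w x → Step y z → Step (w ⊓ y) (x ⊓ z)
Step-⊓ {w} {x} {y} {z} (w≤x , x≤w+1) (y≤z , z≤y+1) =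
  ℤₚ.⊓-mono-≤ w≤x y≤z ,
  subst (x ⊓ z ≤ᶻ_) (sym (ℤₚ.mono-≤-distrib-⊓ (ℤₚ.+-monoˡ-≤ 1ℤ) w y))
    (ℤₚ.⊓-mono-≤ x≤w+1 z≤y+1)

Step-⊔ : ∀ {w x y z} → Step w x → Step y z → Step (w ⊔ y) (x ⊔ z)
Step-⊔ {w} {x} {y} {z} (w≤x , x≤w+1) (y≤z , z≤y+1) =
  ℤₚ.⊔-mono-≤ w≤x y≤z ,
  subst (x ⊔ z ≤ᶻ_) (sym (ℤₚ.mono-≤-distrib-⊔ (ℤₚ.+-monoˡ-≤ 1ℤ) w y))
    (ℤₚ.⊔-mono-≤ x≤w+1 z≤y+1)

-- Partial sums

-- partialSum does not unfold along the vector: ⌊ toℕ p <? i ⌋ and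
-- ⌊ suc (toℕ p) <? suc i ⌋ are not definitionally equal.
prefixSum : ℕ → Vector ℤ n → ℤ
prefixSum zero x = 0ℤ
prefixSum {n = zero} (suc i) x = 0ℤ
prefixSum {n = suc n} (suc i) x = x zero + prefixSum i (tail x)

partialSum≡prefixSum : ∀ i (x : Vector ℤ n) → partialSum i x ≡ prefixSum i x
partialSum≡prefixSum {n} i x = trans
  (sum-cong-≗ λ p → cong (if_then x p else 0ℤ) (isYes≗does (toℕ p ℕₚ.<? i)))
  (∑-if i x)
  where
  ∑-if : ∀ {n} i (x : Vector ℤ n) →
    ∑ (λ p → if does (toℕ p ℕₚ.<? i) then x p else 0ℤ) ≡ prefixSum i x
  ∑-if {zero} zero x = refl
  ∑-if {zero} (suc i) x = refl
  ∑-if {suc n} zero x = trans (ℤₚ.+-identityˡ _) (∑-if zero (tail x))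
  ∑-if {suc n} (suc i) x = cong (_+_ (x zero)) (∑-if i (tail x))

prefixSum-cong : ∀ i {x y : Vector ℤ n} → (∀ p → x p ≡ y p) → prefixSum i x ≡ prefixSum i y
prefixSum-cong zero _ = refl
prefixSum-cong {n = zero} (suc i) _ = refl
prefixSum-cong {n = suc n} (suc i) x≗y = cong₂ _+_ (x≗y zero) (prefixSum-cong i (x≗y ∘ suc))

prefixSum-0s : ∀ i {x : Vector ℤ n} → (∀ p → x p ≡ 0ℤ) → prefixSum i x ≡ 0ℤ
prefixSum-0s zero _ = refl
prefixSum-0s {n = zero} (suc i) _ = refl
prefixSum-0s {n = suc n} (suc i) x≗0 = cong₂ _+_ (x≗0 zero) (prefixSum-0s i (x≗0 ∘ suc))

prefixSum-1s : ∀ {i} {x : Vector ℤ n} → i ≤ n → (∀ p → x p ≡ 1ℤ) → prefixSum i x ≡ + i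
prefixSum-1s z≤n _ = refl
prefixSum-1s (s≤s i≤n) x≗1 = cong₂ _+_ (x≗1 zero) (prefixSum-1s i≤n (x≗1 ∘ suc))

prefixSum-all : (x : Vector ℤ n) → prefixSum n x ≡ ∑ x
prefixSum-all {n = zero} x = refl
prefixSum-all {n = suc n} x = cong (_+_ (x zero)) (prefixSum-all (tail x))

prefixSum-+ : ∀ i (x y : Vector ℤ n) →
  prefixSum i (λ p → x p + y p) ≡ prefixSum i x + prefixSum i y
prefixSum-+ zero x y = refl
prefixSum-+ {n = zero} (suc i) x y = refl
prefixSum-+ {n = suc n} (suc i) x y =
  trans (cong (_+_ (x zero + y zero)) (prefixSum-+ i (tail x) (tail y)))
    (interchange (x zero) (y zero) _ _)
  where
  interchange : ∀ a b c d → (a + b) + (c + d) ≡ (a + c) + (b + d)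
  interchange = solve-∀

prefixSum-comm : ∀ i j (X : Fin m → Fin n → ℤ) →
  prefixSum i (λ p → prefixSum j (X p)) ≡ prefixSum j (λ q → prefixSum i (λ p → X p q))
prefixSum-comm zero j X = sym (prefixSum-0s j λ _ → refl)
prefixSum-comm {m = zero} (suc i) j X = sym (prefixSum-0s j λ _ → refl)
prefixSum-comm {m = suc m} (suc i) j X =
  trans (cong (_+_ (prefixSum j (X zero))) (prefixSum-comm i j (tail X)))
    (sym (prefixSum-+ j (X zero) (λ q → prefixSum i (λ p → X (suc p) q))))

prefixSum-telescope : ∀ {i} (g : ℕ → ℤ) (x : Vector ℤ n) → i ≤ n →
  (∀ p → x p ≡ g (suc (toℕ p)) - g (toℕ p)) → prefixSum i x ≡ g i - g 0
prefixSum-telescope g x z≤n _ = sym (ℤₚ.+-inverseʳ (g 0))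
prefixSum-telescope {i = suc i} g x (s≤s i≤n) x≗ =
  trans (cong₂ _+_ (x≗ zero) (prefixSum-telescope (g ∘ suc) (tail x) i≤n (x≗ ∘ suc)))
    (cancel (g 0) (g 1) (g (suc i)))
  where
  cancel : ∀ a b c → (b - a) + (c - b) ≡ c - a
  cancel = solve-∀

prefixSum-step : ∀ i {x : Vector ℤ n} → (∀ p → Bit (x p)) →
  Step (prefixSum i x) (prefixSum (suc i) x)
prefixSum-step {n = zero} zero _ = Step-refl
prefixSum-step {n = zero} (suc i) _ = Step-refl
prefixSum-step {n = suc n} zero {x} bits =
  subst (Step 0ℤ) (ℤₚ.+-comm 0ℤ (x zero)) (Step-+-Bit 0ℤ (bits zero))
prefixSum-step {n = suc n} (suc i) {x} bits = Step-+ˡ (x zero) (prefixSum-step i (bits ∘ suc))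

-- Alternating vectors and their partial sums

Entry : ℤ → Set
Entry z = z ≡ 0ℤ ⊎ z ≡ 1ℤ ⊎ z ≡ -1ℤ

Leads : ℤ → Vector ℤ n → Set
Leads s x = ∃ λ p → x p ≡ s × (∀ q → q Fin.< p → x q ≡ 0ℤ)

Is±1 : ℤ → Set
Is±1 s = s ≡ 1ℤ ⊎ s ≡ -1ℤ

±1⇒≢0 : ∀ {s} → Is±1 s → s ≢ 0ℤ
±1⇒≢0 (inj₁ refl) ()
±1⇒≢0 (inj₂ refl) ()

opposite-cancel : ∀ {s t} → Is±1 s → Is±1 t → sign t ≡ opposite (sign s) → s + t ≡ 0ℤ
opposite-cancel (inj₁ refl) (inj₁ refl) ()
opposite-cancel (inj₁ refl) (inj₂ refl) _ = refl
opposite-cancel (inj₂ refl) (inj₁ refl) _ = refl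
opposite-cancel (inj₂ refl) (inj₂ refl) ()

Alternating-tail : {x : Vector ℤ (suc n)} → Alternating x → Alternating (tail x)
Alternating-tail alt p q p<q xp≢0 xq≢0 between =
  alt (suc p) (suc q) (s≤s p<q) xp≢0 xq≢0 λ where
    zero ()
    (suc s) (s≤s p<s) (s≤s s<q) → between s p<s s<q

-- Induction on the vector. A nonzero head is opposite to the first nonzero entry `s` of the tail,
-- so adding it to sums in `{0, s}` gives sums in `{x zero, 0}`. The witness `Leads` is carried
-- along because `alt` has to be applied to that first nonzero entry.
alternating-prefixSums : {x : Vector ℤ n} → (∀ p → Entry (x p)) → Alternating x →
  (∀ p → x p ≡ 0ℤ) ⊎
  (∃ λ s → Is±1 s × Leads s x × ∀ i → prefixSum i x ≡ 0ℤ ⊎ prefixSum i x ≡ s)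
alternating-prefixSums {n = zero} _ _ = inj₁ λ ()
alternating-prefixSums {n = suc n} {x} entries alt
  with entries zero | alternating-prefixSums (entries ∘ suc) (Alternating-tail alt)
... | inj₁ x₀≡0 | inj₁ rest = inj₁ λ { zero → x₀≡0 ; (suc p) → rest p }
... | inj₁ x₀≡0 | inj₂ (s , s≢0 , (p , xp≡s , before) , sums) =
  inj₂ (s , s≢0 , (suc p , xp≡s , before′) , sums′)
  where
  before′ : ∀ q → q Fin.< suc p → x q ≡ 0ℤ
  before′ zero _ = x₀≡0
  before′ (suc q) (s≤s q<p) = before q q<p

  sums′ : ∀ i → prefixSum i x ≡ 0ℤ ⊎ prefixSum i x ≡ s
  sums′ zero = inj₁ refl
  sums′ (suc i) rewrite x₀≡0 | ℤₚ.+-identityˡ (prefixSum i (tail x)) = sums i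
... | inj₂ x₀≢0 | rest =
  inj₂ (x zero , x₀≢0 , (zero , refl , λ _ ()) , sums′ rest)
  where
  sums′ : (∀ p → x (suc p) ≡ 0ℤ) ⊎
    (∃ λ s → Is±1 s × Leads s (tail x) ×
      ∀ i → prefixSum i (tail x) ≡ 0ℤ ⊎ prefixSum i (tail x) ≡ s) →
    ∀ i → prefixSum i x ≡ 0ℤ ⊎ prefixSum i x ≡ x zero
  sums′ _ zero = inj₁ refl
  sums′ (inj₁ zeros) (suc i) rewrite prefixSum-0s i zeros = inj₂ (ℤₚ.+-identityʳ _)
  sums′ (inj₂ (s , s≢0 , (p , refl , before) , sums)) (suc i) with sums i
  ... | inj₁ sum≡0 rewrite sum≡0 = inj₂ (ℤₚ.+-identityʳ _)
  ... | inj₂ sum≡s rewrite sum≡s = inj₁ (opposite-cancel x₀≢0 s≢0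
    (alt zero (suc p) (s≤s z≤n) (±1⇒≢0 x₀≢0) (±1⇒≢0 s≢0) λ where
      zero ()
      (suc q) _ (s≤s q<p) → before q q<p))

-- A leading `-1ℤ` would put every prefix sum, and with it the total, in `{0, -1}`, against the
-- total being `1ℤ`.
alternating⇒Bit : {x : Vector ℤ n} → (∀ p → Entry (x p)) → Alternating x → ∑ x ≡ 1ℤ →
  ∀ i → Bit (prefixSum i x)
alternating⇒Bit {n = n} {x} entries alt sum≡1 i
  with trans (prefixSum-all x) sum≡1 | alternating-prefixSums entries alt
... | total | inj₁ zeros = inj₁ (prefixSum-0s i zeros)
... | total | inj₂ (_ , inj₁ refl , _ , sums) = sums i
... | total | inj₂ (_ , inj₂ refl , _ , sums) with sums n
...   | inj₁ sum≡0  = contradiction (trans (sym total) sum≡0) λ ()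
...   | inj₂ sum≡-1 = contradiction (trans (sym total) sum≡-1) λ ()

-- Difference vectors of 0-1 sequences

constant-between : (g : ℕ → ℤ) → ∀ {a b} → a ≤ b →
  (∀ c → a ≤ c → c < b → g (suc c) ≡ g c) → g b ≡ g a
constant-between g {b = zero} z≤n _ = refl
constant-between g {a} {suc b} a≤1+b const with ℕₚ.m≤n⇒m<n∨m≡n a≤1+b
... | inj₂ refl = refl
... | inj₁ (s≤s a≤b) = trans (const b a≤b ℕₚ.≤-refl)
  (constant-between g a≤b λ c a≤c c<b → const c a≤c (ℕₚ.m<n⇒m<1+n c<b))

Bit-alternating : ∀ {a b c} → Bit a → Bit b → Bit c → b - a ≢ 0ℤ → c - b ≢ 0ℤ →
  sign (c - b) ≡ opposite (sign (b - a))
Bit-alternating (inj₁ refl) (inj₁ refl) _ b≢a _ = contradiction refl b≢a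
Bit-alternating (inj₂ refl) (inj₂ refl) _ b≢a _ = contradiction refl b≢a
Bit-alternating (inj₂ refl) (inj₁ refl) (inj₁ refl) _ c≢b = contradiction refl c≢b
Bit-alternating (inj₁ refl) (inj₂ refl) (inj₂ refl) _ c≢b = contradiction refl c≢b
Bit-alternating (inj₁ refl) (inj₂ refl) (inj₁ refl) _ _ = refl
Bit-alternating (inj₂ refl) (inj₁ refl) (inj₂ refl) _ _ = refl

module _ (g : ℕ → ℤ) (bits : ∀ i → Bit (g i))
         (x : Vector ℤ n) (x≗ : ∀ p → x p ≡ g (suc (toℕ p)) - g (toℕ p)) where

  difference-entry : ∀ p → Entry (x p)
  difference-entry p rewrite x≗ p
    with g (toℕ p) | bits (toℕ p)
       | g (suc (toℕ p)) | bits (suc (toℕ p))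
  ... | _ | inj₁ refl | _ | inj₁ refl = inj₁ refl
  ... | _ | inj₁ refl | _ | inj₂ refl = inj₂ (inj₁ refl)
  ... | _ | inj₂ refl | _ | inj₁ refl = inj₂ (inj₂ refl)
  ... | _ | inj₂ refl | _ | inj₂ refl = inj₁ refl

  difference-constant : (p q : Fin n) → p Fin.< q → (∀ s → p Fin.< s → s Fin.< q → x s ≡ 0ℤ) →
    g (toℕ q) ≡ g (suc (toℕ p))
  difference-constant p q p<q between = constant-between g p<q constant
    where
    constant : ∀ c → toℕ p < c → c < toℕ q → g (suc c) ≡ g c
    constant c p<c c<q = ℤₚ.i-j≡0⇒i≡j _ _
      (subst (λ d → g (suc d) - g d ≡ 0ℤ) c≡
        (trans (sym (x≗ s)) (between s (subst (toℕ p <_) (sym c≡) p<c)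
                                       (subst (_< toℕ q) (sym c≡) c<q))))
      where
      c<n = ℕₚ.<-trans c<q (toℕ<n q)
      s : Fin n
      s = fromℕ< c<n
      c≡ : toℕ s ≡ c
      c≡ = toℕ-fromℕ< c<n

  -- The sequence `g` is constant between two successive nonzero differences, so both are
  -- differences of three bits. A bit that has changed can only change back.
  difference-alternating : Alternating x
  difference-alternating p q p<q xp≢0 xq≢0 between =
    subst₂ (λ s t → sign t ≡ opposite (sign s)) (sym xp≡) (sym xq≡)
      (Bit-alternating (bits (toℕ p)) (bits (suc (toℕ p))) (bits (suc (toℕ q)))
        (xp≢0 ∘ trans xp≡) (xq≢0 ∘ trans xq≡))
    where
    xp≡ = x≗ p
    xq≡ = trans (x≗ q) (cong (_-_ (g (suc (toℕ q)))) (difference-constant p q p<q between))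

  difference-sum : g 0 ≡ 0ℤ → g n ≡ 1ℤ → ∑ x ≡ 1ℤ
  difference-sum g0≡0 gn≡1 = begin
    ∑ x              ≡⟨ prefixSum-all x ⟨
    prefixSum n x   ≡⟨ prefixSum-telescope g x ℕₚ.≤-refl x≗ ⟩
    g n - g 0        ≡⟨ cong₂ _-_ gn≡1 g0≡0 ⟩
    1ℤ               ∎
    where open ≡-Reasoning

-- Rank functions

-- Steps are required at all indices, also past `n`, where `r` is constant. There `bottom` and
-- `right` fail for `r`, hence their bounds.
record IsRankFunction (n : ℕ) (h : ℕ → ℕ → ℤ) : Set where
  field
    row-step : ∀ i j → Step (h i j) (h (suc i) j)
    col-step : ∀ i j → Step (h i j) (h i (suc j))
    top      : ∀ j → h 0 j ≡ 0ℤ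
    left     : ∀ {i} → i ≤ n → h i 0 ≡ 0ℤ
    bottom   : ∀ {j} → j ≤ n → h n j ≡ + j
    right    : ∀ {i} → i ≤ n → h i n ≡ + i

r≡prefixSum : (A : ASM n) → ∀ i j → r A i j ≡ prefixSum i (λ p → prefixSum j (proj₁ A p))
r≡prefixSum A i j = trans (partialSum≡prefixSum i _)
  (prefixSum-cong i λ p → partialSum≡prefixSum j (proj₁ A p))

r≡prefixSumᵀ : (A : ASM n) → ∀ i j →
  r A i j ≡ prefixSum j (λ q → prefixSum i (λ p → proj₁ A p q))
r≡prefixSumᵀ A i j = trans (r≡prefixSum A i j) (prefixSum-comm i j (proj₁ A))

-- Going down one row adds a prefix sum of that row, which is a bit by alternation. For columns the
-- order of summation is exchanged first.
r-isRankFunction : (A : ASM n) → IsRankFunction n (r A)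
r-isRankFunction A@(M , asm) = record
  { row-step = λ i j → subst₂ Step (sym (r≡prefixSum A i j)) (sym (r≡prefixSum A (suc i) j))
                 (prefixSum-step i (λ p → row-bits p j))
  ; col-step = λ i j → subst₂ Step (sym (r≡prefixSumᵀ A i j)) (sym (r≡prefixSumᵀ A i (suc j)))
                 (prefixSum-step j (λ q → col-bits q i))
  ; top      = λ j → r≡prefixSum A 0 j
  ; left     = λ {i} _ → r≡prefixSumᵀ A i 0
  ; bottom   = λ {j} j≤n → trans (r≡prefixSumᵀ A _ j)
                 (prefixSum-1s j≤n λ q → trans (prefixSum-all (λ p → M p q)) (col-sum q))
  ; right    = λ {i} i≤n → trans (r≡prefixSum A i _)
                 (prefixSum-1s i≤n λ p → trans (prefixSum-all (M p)) (row-sum p))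
  }
  where
  open IsASM asm
  row-bits : ∀ p j → Bit (prefixSum j (M p))
  row-bits p = alternating⇒Bit (entries p) (row-alternating p) (row-sum p)
  col-bits : ∀ q i → Bit (prefixSum i (λ p → M p q))
  col-bits q = alternating⇒Bit (λ p → entries p q) (col-alternating q) (col-sum q)

-- Reconstruction of an ASM from its rank function

module FromRankFunction {h : ℕ → ℕ → ℤ} (rank : IsRankFunction n h) where
  open IsRankFunction rank

  rowSum : ℕ → ℕ → ℤ
  rowSum i j = h (suc i) j - h i j

  colSum : ℕ → ℕ → ℤ
  colSum j i = h i (suc j) - h i j

  -- The mixed second difference of `h`, bracketed so that each row is definitionally a difference
  -- vector. The columns need the regrouping `matrix-cols`.
  matrix : Matrix n
  matrix p q = rowSum (toℕ p) (suc (toℕ q)) - rowSum (toℕ p) (toℕ q)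

  matrix-cols : ∀ q p → matrix p q ≡ colSum (toℕ q) (suc (toℕ p)) - colSum (toℕ q) (toℕ p)
  matrix-cols q p = exchange (h (suc (toℕ p)) (suc (toℕ q))) (h (toℕ p) (suc (toℕ q))) _ _
    where
    exchange : ∀ a b c d → (a - b) - (c - d) ≡ (a - c) - (b - d)
    exchange = solve-∀

  rowSum-bits : ∀ i j → Bit (rowSum i j)
  rowSum-bits i j = Bit-difference (row-step i j)

  colSum-bits : ∀ j i → Bit (colSum j i)
  colSum-bits j i = Bit-difference (col-step i j)

  suc-difference : ∀ i → + suc i - + i ≡ 1ℤ
  suc-difference i = trans (cong (_- + i) (ℤₚ.+-comm 1ℤ (+ i))) (cancel (+ i))
    where
    cancel : ∀ a → (a + 1ℤ) - a ≡ 1ℤ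
    cancel = solve-∀

  rowSum-0 : ∀ {i} → i < n → rowSum i 0 ≡ 0ℤ
  rowSum-0 i<n = cong₂ _-_ (left i<n) (left (ℕₚ.<⇒≤ i<n))

  matrix-isASM : IsASM matrix
  matrix-isASM = record
    { entries         = λ p → difference-entry (rowSum (toℕ p)) (rowSum-bits (toℕ p))
                          (matrix p) (λ _ → refl)
    ; row-alternating = λ p → difference-alternating (rowSum (toℕ p))
                          (rowSum-bits (toℕ p)) (matrix p) (λ _ → refl)
    ; col-alternating = λ q → difference-alternating (colSum (toℕ q))
                          (colSum-bits (toℕ q)) (λ p → matrix p q) (matrix-cols q)
    ; row-sum         = λ p → difference-sum (rowSum (toℕ p))
                          (rowSum-bits (toℕ p)) (matrix p) (λ _ → refl)
                          (rowSum-0 (toℕ<n p))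
                          (trans (cong₂ _-_ (right (toℕ<n p)) (right (ℕₚ.<⇒≤ (toℕ<n p))))
                            (suc-difference (toℕ p)))
    ; col-sum         = λ q → difference-sum (colSum (toℕ q))
                          (colSum-bits (toℕ q)) (λ p → matrix p q) (matrix-cols q)
                          (cong₂ _-_ (top (suc (toℕ q))) (top (toℕ q)))
                          (trans (cong₂ _-_ (bottom (toℕ<n q)) (bottom (ℕₚ.<⇒≤ (toℕ<n q))))
                            (suc-difference (toℕ q)))
    }

  asm : ASM n
  asm = matrix , matrix-isASM

  -- The double sum telescopes along each row and then down the rows; `left` and `top` remove the
  -- boundary terms.
  r-asm : ∀ {i j} → i ≤ n → j ≤ n → r asm i j ≡ h i j
  r-asm {i} {j} i≤n j≤n = begin
    r asm i j                                  ≡⟨ r≡prefixSum asm i j ⟩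
    prefixSum i (λ p → prefixSum j (matrix p)) ≡⟨ prefixSum-cong i row ⟩
    prefixSum i (λ p → rowSum (toℕ p) j)      ≡⟨ prefixSum-telescope (λ i → h i j) _ i≤n (λ _ → refl) ⟩
    h i j - h 0 j                              ≡⟨ cong (_-_ (h i j)) (top j) ⟩
    h i j - 0ℤ                                 ≡⟨ ℤₚ.+-identityʳ _ ⟩
    h i j                                      ∎
    where
    open ≡-Reasoning
    row : ∀ p → prefixSum j (matrix p) ≡ rowSum (toℕ p) j
    row p = begin
      prefixSum j (matrix p)              ≡⟨ prefixSum-telescope (rowSum (toℕ p)) _ j≤n (λ _ → refl) ⟩
      rowSum (toℕ p) j - rowSum (toℕ p) 0  ≡⟨ cong (_-_ (rowSum (toℕ p) j)) (rowSum-0 (toℕ<n p)) ⟩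
      rowSum (toℕ p) j - 0ℤ                ≡⟨ ℤₚ.+-identityʳ _ ⟩
      rowSum (toℕ p) j                     ∎

-- Concave closure

module ConcaveClosure {P : ℕ → Set} (P? : Decidable P) (n : ℕ)
                      (¬P0 : ¬ P 0) (P⇒<n : ∀ {i} → P i → i < n) where

  Steps : (ℕ → ℤ) → Set
  Steps f = ∀ i → Step (f i) (f (suc i))

  Concave : (ℕ → ℤ) → Set
  Concave f = ∀ i → P i → f i ≡ f (i ∸ 1) + 1ℤ ⊎ f i ≡ f (suc i)

  -- The bound from the left: the value at the last index outside `P`, continued with slope 1. The
  -- bound from the right is `stay`.
  rise : (ℕ → ℤ) → ℕ → ℤ
  rise f zero = f zero
  rise f (suc i) = if does (P? (suc i)) then rise f i + 1ℤ else f (suc i)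

  -- Every run of P ends by n, so n ∸ i units of fuel reach its end from i.
  stayFor : ℕ → (ℕ → ℤ) → ℕ → ℤ
  stayFor zero f i = f i
  stayFor (suc k) f i = if does (P? i) then stayFor k f (suc i) else f i

  stay : (ℕ → ℤ) → ℕ → ℤ
  stay f i = stayFor (n ∸ i) f i

  closure : (ℕ → ℤ) → ℕ → ℤ
  closure f i = stay f i ⊓ rise f i

  rise-∈ : ∀ f i → P (suc i) → rise f (suc i) ≡ rise f i + 1ℤ
  rise-∈ f i p with P? (suc i)
  ... | yes _ = refl
  ... | no ¬p = contradiction p ¬p

  rise-∉ : ∀ f i → ¬ P i → rise f i ≡ f i
  rise-∉ f zero _ = refl
  rise-∉ f (suc i) ¬p with P? (suc i)
  ... | yes p = contradiction p ¬p
  ... | no _ = refl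

  stay-∈ : ∀ f i → P i → stay f i ≡ stay f (suc i)
  -- Since `i < n`, the fuel `n ∸ i` is `suc (n ∸ suc i)`, and one unfolding leaves exactly the fuel
  -- of `stay f (suc i)`.
  stay-∈ f i p rewrite ℕₚ.+-∸-assoc 1 (P⇒<n p) with P? i
  ... | yes _ = refl
  ... | no ¬p = contradiction p ¬p

  stay-∉ : ∀ f i → ¬ P i → stay f i ≡ f i
  stay-∉ f i ¬p with n ∸ i
  ... | zero = refl
  ... | suc _ with P? i
  ...   | yes p = contradiction p ¬p
  ...   | no _ = refl

  closure-∉ : ∀ f i → ¬ P i → closure f i ≡ f i
  closure-∉ f i ¬p = trans (cong₂ _⊓_ (stay-∉ f i ¬p) (rise-∉ f i ¬p)) (ℤₚ.⊓-idem (f i))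

  module _ {f g : ℕ → ℤ} (f→g : ∀ i → Step (f i) (g i)) where

    rise-Step : ∀ i → Step (rise f i) (rise g i)
    rise-Step zero = f→g zero
    rise-Step (suc i) with P? (suc i)
    ... | yes _ = Step-+1 (rise-Step i)
    ... | no _ = f→g (suc i)

    stayFor-Step : ∀ k i → Step (stayFor k f i) (stayFor k g i)
    stayFor-Step zero i = f→g i
    stayFor-Step (suc k) i with P? i
    ... | yes _ = stayFor-Step k (suc i)
    ... | no _ = f→g i

    -- Each bound at `i` is the value of the function at one index plus a constant, and both index
    -- and constant depend on `P` alone. Applied to adjacent columns, this gives the unit steps
    -- along the rows of the closed rank function.
    closure-Step : ∀ i → Step (closure f i) (closure g i)
    closure-Step i = Step-⊓ (stayFor-Step (n ∸ i) i) (rise-Step i)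

  module _ {f : ℕ → ℤ} (steps : Steps f) where

    f≤rise : ∀ i → f i ≤ᶻ rise f i
    f≤rise zero = ℤₚ.≤-refl
    f≤rise (suc i) with P? (suc i)
    ... | yes _ = ℤₚ.≤-trans (proj₂ (steps i)) (ℤₚ.+-monoˡ-≤ 1ℤ (f≤rise i))
    ... | no _ = ℤₚ.≤-refl

    f≤stayFor : ∀ k i → f i ≤ᶻ stayFor k f i
    f≤stayFor zero i = ℤₚ.≤-refl
    f≤stayFor (suc k) i with P? i
    ... | yes _ = ℤₚ.≤-trans (proj₁ (steps i)) (f≤stayFor k (suc i))
    ... | no _ = ℤₚ.≤-refl

    f≤stay : ∀ i → f i ≤ᶻ stay f i
    f≤stay i = f≤stayFor (n ∸ i) i

    f≤closure : ∀ i → f i ≤ᶻ closure f i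
    f≤closure i = ℤₚ.⊓-glb (f≤stay i) (f≤rise i)

    -- Within a run of `P`, `stay` is constant and `rise` climbs by 1. At either end of a run one of
    -- the two values is that of `f` itself, and the inequalities follow from the steps of `f`
    -- together with `f≤stay` or `f≤rise`.
    closure-step : ∀ i → Dec (P i) → Dec (P (suc i)) → Step (closure f i) (closure f (suc i))
    closure-step i (yes p) (yes p⁺) = subst₂ Step
      (cong (_⊓ rise f i) (sym (stay-∈ f i p)))
      (cong (stay f (suc i) ⊓_) (sym (rise-∈ f i p⁺)))
      (Step-⊓ Step-refl (x≤x+1 _ , ℤₚ.≤-refl))
    closure-step i (no ¬p) (yes p⁺) =
      subst₂ (λ x y → Step x (stay f (suc i) ⊓ y))
        (sym (closure-∉ f i ¬p)) (sym (trans (rise-∈ f i p⁺) (cong (_+ 1ℤ) (rise-∉ f i ¬p))))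
        ( ℤₚ.⊓-glb (ℤₚ.≤-trans (proj₁ (steps i)) (f≤stay (suc i))) (x≤x+1 (f i))
        , ℤₚ.i⊓j≤j (stay f (suc i)) (f i + 1ℤ))
    closure-step i (yes p) (no ¬p⁺) =
      subst₂ (λ x y → Step (x ⊓ rise f i) y)
        (sym (trans (stay-∈ f i p) (stay-∉ f (suc i) ¬p⁺))) (sym (closure-∉ f (suc i) ¬p⁺))
        ( ℤₚ.i⊓j≤i (f (suc i)) (rise f i)
        , subst (f (suc i) ≤ᶻ_) (sym (ℤₚ.mono-≤-distrib-⊓ (ℤₚ.+-monoˡ-≤ 1ℤ) (f (suc i)) (rise f i)))
            (ℤₚ.⊓-glb (x≤x+1 _) (ℤₚ.≤-trans (proj₂ (steps i)) (ℤₚ.+-monoˡ-≤ 1ℤ (f≤rise i)))))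
    closure-step i (no ¬p) (no ¬p⁺) =
      subst₂ Step (sym (closure-∉ f i ¬p)) (sym (closure-∉ f (suc i) ¬p⁺)) (steps i)

    closure-steps : Steps (closure f)
    closure-steps i = closure-step i (P? i) (P? (suc i))

    -- The bound attaining the minimum at `i` decides: if it is `stay`, the closure cannot grow in
    -- the next step; if it is `rise`, the closure has just grown by 1.
    closure-concave : Concave (closure f)
    closure-concave zero p = contradiction p ¬P0
    closure-concave (suc i) p with ℤₚ.≤-total (stay f (suc i)) (rise f (suc i))
    ... | inj₁ stay≤rise = inj₂ (ℤₚ.≤-antisym (proj₁ (closure-steps (suc i))) (begin
      closure f (2 ℕ.+ i)  ≤⟨ ℤₚ.i⊓j≤i _ _ ⟩
      stay f (2 ℕ.+ i)     ≡⟨ stay-∈ f (suc i) p ⟨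
      stay f (suc i)       ≡⟨ ℤₚ.i≤j⇒i⊓j≡i stay≤rise ⟨
      closure f (suc i)    ∎))
      where open ℤₚ.≤-Reasoning
    ... | inj₂ rise≤stay = inj₁ (ℤₚ.≤-antisym (proj₂ (closure-steps i)) (begin
      closure f i + 1ℤ     ≤⟨ ℤₚ.+-monoˡ-≤ 1ℤ (ℤₚ.i⊓j≤j (stay f i) (rise f i)) ⟩
      rise f i + 1ℤ        ≡⟨ rise-∈ f i p ⟨
      rise f (suc i)       ≡⟨ ℤₚ.i≥j⇒i⊓j≡j rise≤stay ⟨
      closure f (suc i)    ∎))
      where open ℤₚ.≤-Reasoning

  x≢x+1 : ∀ {x y} → x ≡ y + 1ℤ → y ≢ x
  x≢x+1 {y = y} x≡y+1 y≡x = ℤₚ.i≢suc[i] (trans y≡x (trans x≡y+1 (ℤₚ.+-comm y 1ℤ)))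

  module _ {f h : ℕ → ℤ} (concave : Concave h) (f≤h : ∀ i → i ≤ n → f i ≤ᶻ h i) where

    -- A step of 1 into `i` excludes the flat alternative at `i ∸ 1`, so slope 1 propagates
    -- backwards to the start of the run, where `h` dominates `f`.
    rise≤ : ∀ i → i ≤ n → (P i → h i ≡ h (i ∸ 1) + 1ℤ) → rise f i ≤ᶻ h i
    rise≤ zero i≤n _ = f≤h 0 i≤n
    rise≤ (suc i) i<n up with P? (suc i)
    ... | no _ = f≤h (suc i) i<n
    ... | yes p = subst (rise f i + 1ℤ ≤ᶻ_) (sym (up p))
      (ℤₚ.+-monoˡ-≤ 1ℤ (rise≤ i (ℕₚ.<⇒≤ i<n) λ q →
        [ (λ e → e) , (λ e → contradiction e (x≢x+1 (up p))) ]′ (concave i q)))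

    -- The mirror image of `rise≤`: a flat step out of `i` propagates forwards to the end of the
    -- run.
    stayFor≤ : ∀ k i → i ≤ n → (P i → h i ≡ h (suc i)) → stayFor k f i ≤ᶻ h i
    stayFor≤ zero i i≤n _ = f≤h i i≤n
    stayFor≤ (suc k) i i≤n flat with P? i
    ... | no _ = f≤h i i≤n
    ... | yes p = subst (stayFor k f (suc i) ≤ᶻ_) (sym (flat p))
      (stayFor≤ k (suc i) (P⇒<n p) λ q →
        [ (λ e → contradiction (flat p) (x≢x+1 e)) , (λ e → e) ]′ (concave (suc i) q))

    closure-least : ∀ i → i ≤ n → closure f i ≤ᶻ h i
    closure-least i i≤n with P? i
    ... | no ¬p = subst (_≤ᶻ h i) (sym (closure-∉ f i ¬p)) (f≤h i i≤n)
    ... | yes p with concave i p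
    ...   | inj₁ up = ℤₚ.≤-trans (ℤₚ.i⊓j≤j (stay f i) (rise f i)) (rise≤ i i≤n λ _ → up)
    ...   | inj₂ flat =
      ℤₚ.≤-trans (ℤₚ.i⊓j≤i (stay f i) (rise f i)) (stayFor≤ (n ∸ i) i i≤n λ _ → flat)

  -- A concave `f` is a concave majorant of itself. This keeps the boundary columns `0` and `n` of a
  -- rank function unchanged.
  closure-fixed : ∀ {f} → Steps f → Concave f → ∀ i → i ≤ n → closure f i ≡ f i
  closure-fixed steps concave i i≤n =
    ℤₚ.≤-antisym (closure-least concave (λ _ _ → ℤₚ.≤-refl) i i≤n) (f≤closure steps i)

  -- Where `m` touches `f` from below, its neighbouring values are at most those of `f`, so a full
  -- step into `i` or a flat step out of `i` passes from `f` to `m`. A minimum touches one of its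
  -- two arguments at every index.
  concave-at-contact : ∀ {f m} → Steps m → (∀ i → m i ≤ᶻ f i) → Concave f →
    ∀ i → P i → m i ≡ f i → m i ≡ m (i ∸ 1) + 1ℤ ⊎ m i ≡ m (suc i)
  concave-at-contact steps m≤f concave zero p _ = contradiction p ¬P0
  concave-at-contact {f} {m} steps m≤f concave (suc i) p m≡f with concave (suc i) p
  ... | inj₁ up = inj₁ (ℤₚ.≤-antisym (proj₂ (steps i))
    (subst (m i + 1ℤ ≤ᶻ_) (sym (trans m≡f up)) (ℤₚ.+-monoˡ-≤ 1ℤ (m≤f i))))
  ... | inj₂ flat = inj₂ (ℤₚ.≤-antisym (proj₁ (steps (suc i)))
    (subst (m (suc (suc i)) ≤ᶻ_) (sym (trans m≡f flat)) (m≤f (suc (suc i)))))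

  ⊓-concave : ∀ {f g} → Steps f → Steps g → Concave f → Concave g → Concave (λ i → f i ⊓ g i)
  ⊓-concave {f} {g} sf sg cf cg i p =
    [ concave-at-contact steps (λ i → ℤₚ.i⊓j≤i (f i) (g i)) cf i p
    , concave-at-contact steps (λ i → ℤₚ.i⊓j≤j (f i) (g i)) cg i p
    ]′ (ℤₚ.⊓-sel (f i) (g i))
    where
    steps : Steps (λ i → f i ⊓ g i)
    steps i = Step-⊓ (sf i) (sg i)

  -- Here `b` may lie outside `P`, because `stay` looks forward; in `rise-interval` it is `a` that
  -- may, because `rise` looks back.
  stay-interval : ∀ f {a b} → a ≤ b → (∀ c → a ≤ c → c < b → P c) → stay f a ≡ stay f b
  stay-interval f a≤b inside =
    sym (constant-between (stay f) a≤b λ c a≤c c<b → sym (stay-∈ f c (inside c a≤c c<b)))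

  rise-interval : ∀ f {a b} → a ≤ b → (∀ c → a < c → c ≤ b → P c) →
    rise f b ≡ rise f a + (+ b - + a)
  rise-interval f {a} {b} a≤b inside = begin
    rise f b                         ≡⟨ split (rise f b) (+ b) (+ a) ⟩
    height b + (+ b - + a)           ≡⟨ cong (_+ (+ b - + a)) height-constant ⟩
    height a + (+ b - + a)           ≡⟨ cong (_+ (+ b - + a)) (height-a (rise f a) (+ a)) ⟩
    rise f a + (+ b - + a)           ∎
    where
    open ≡-Reasoning
    -- Subtracting the line of slope 1 makes `rise f` constant on the interval, so
    -- `constant-between` applies.
    height : ℕ → ℤ
    height c = rise f c - (+ c - + a)
    split : ∀ x y z → x ≡ (x - (y - z)) + (y - z)
    split = solve-∀
    height-a : ∀ x y → x - (y - y) ≡ x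
    height-a = solve-∀
    shift : ∀ x y z → (x + 1ℤ) - ((1ℤ + y) - z) ≡ x - (y - z)
    shift = solve-∀
    height-constant : height b ≡ height a
    height-constant = constant-between height a≤b λ c a≤c c<b →
      trans (cong (_- (+ suc c - + a)) (rise-∈ f c (inside (suc c) (s≤s a≤c) c<b)))
        (shift (rise f c) (+ c) (+ a))

-- The index set and its maximal intervals

_∈ᴵ?_ : ∀ i (I : Subset m) → Dec (i ∈ᴵ I)
i ∈ᴵ? I = any? λ p → (suc (toℕ p) ℕₚ.≟ i) ×-dec (p ∈? I)

0∉ᴵ : {I : Subset m} → 0 ∉ᴵ I
0∉ᴵ (_ , () , _)

∈ᴵ⇒≤ : ∀ {i} {I : Subset m} → i ∈ᴵ I → i ≤ m
∈ᴵ⇒≤ (p , refl , _) = toℕ<n p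

module Decomposition {k} {I : Subset m} {u v : Fin k → ℕ}
                     (dec : IsIntervalDecomposition I u v) where
  open IsIntervalDecomposition dec

  interval⊆I : ∀ t {i} → u t ≤ i → i ≤ v t → i ∈ᴵ I
  interval⊆I t u≤i i≤v = Equivalence.from (union _) (t , u≤i , i≤v)

  -- Elements of `I` are numbered from 1. Hence the truncated subtraction in `u t ∸ 1` is a true
  -- predecessor.
  u≢0 : ∀ t → u t ≢ 0
  u≢0 t u≡0 = 0∉ᴵ (interval⊆I t (ℕₚ.≤-reflexive u≡0) z≤n)

  suc[u∸1]≡u : ∀ t → suc (u t ∸ 1) ≡ u t
  suc[u∸1]≡u t = ℕₚ.suc-pred (u t) ⦃ ℕ.≢-nonZero (u≢0 t) ⦄

  -- The field `gap` compares only neighbouring intervals. Induction on the number `d` of intervals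
  -- strictly between chains these comparisons through the nonempty interval just before `t`.
  gap-< : ∀ d s t → toℕ t ≡ suc (d ℕ.+ toℕ s) → suc (v s) < u t
  gap-< zero s t t≡1+s = subst (suc (suc (v s)) ≤_) (suc[u∸1]≡u t) (s≤s (gap s t t≡1+s))
  gap-< (suc d) s t t≡ = begin-strict
    suc (v s)  <⟨ gap-< d s t′ t′≡ ⟩
    u t′       ≤⟨ nonempty t′ ⟩
    v t′       ≤⟨ ℕₚ.n≤1+n (v t′) ⟩
    suc (v t′) <⟨ gap-< zero t′ t (trans t≡ (cong suc (sym t′≡))) ⟩
    u t        ∎
    where
    open ℕₚ.≤-Reasoning
    t′<k : suc (d ℕ.+ toℕ s) < k
    t′<k = ℕₚ.<-trans (ℕₚ.≤-reflexive (sym t≡)) (toℕ<n t)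
    t′ : Fin k
    t′ = fromℕ< t′<k
    t′≡ : toℕ t′ ≡ suc (d ℕ.+ toℕ s)
    t′≡ = toℕ-fromℕ< t′<k

  separated : ∀ {s t} → toℕ s < toℕ t → suc (v s) < u t
  separated {s} {t} s<t = gap-< (toℕ t ∸ suc (toℕ s)) s t
    (sym (trans (sym (ℕₚ.+-suc _ (toℕ s))) (ℕₚ.m∸n+n≡m s<t)))

  -- An interval containing this point would come before, after or coincide with the `t`-th one;
  -- `separated` excludes the first two cases and `v t` bounds the third.
  suc-v∉I : ∀ t → suc (v t) ∉ᴵ I
  suc-v∉I t i∈I with Equivalence.to (union _) i∈I
  ... | s , u≤i , i≤v with ℕₚ.<-cmp (toℕ s) (toℕ t)
  ...   | tri< s<t _ _ = ℕₚ.<⇒≱ (separated s<t)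
          (ℕₚ.≤-trans (nonempty t) (ℕₚ.≤-trans (ℕₚ.<⇒≤ i≤v) (ℕₚ.n≤1+n (v s))))
  ...   | tri> _ _ t<s = ℕₚ.<⇒≱ (separated t<s) u≤i
  ...   | tri≈ _ s≡t _ with toℕ-injective s≡t
  ...     | refl = ℕₚ.<-irrefl refl i≤v

  u∸1∉I : ∀ t → u t ∸ 1 ∉ᴵ I
  u∸1∉I t i∈I with Equivalence.to (union _) i∈I
  ... | s , u≤i , i≤v with ℕₚ.<-cmp (toℕ s) (toℕ t)
  ...   | tri< s<t _ _ = ℕₚ.<⇒≱ (separated s<t)
          (subst (_≤ suc (v s)) (suc[u∸1]≡u t) (s≤s i≤v))
  ...   | tri> _ _ t<s = ℕₚ.<⇒≱ (separated t<s)
          (ℕₚ.≤-trans u≤i (ℕₚ.≤-trans (ℕₚ.m∸n≤m (u t) 1)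
            (ℕₚ.≤-trans (nonempty t) (ℕₚ.n≤1+n (v t)))))
  ...   | tri≈ _ s≡t _ with toℕ-injective s≡t
  ...     | refl = ℕₚ.<⇒≱ (ℕₚ.≤-reflexive (suc[u∸1]≡u t)) u≤i

-- Joins and meets

module Lattice {n} (1≤n : 1 ≤ n) (I : Subset (n ∸ 1)) where

  ∈ᴵ⇒< : ∀ {i} → i ∈ᴵ I → i < n
  ∈ᴵ⇒< i∈I = subst (suc _ ≤_) (ℕₚ.suc-pred n ⦃ ℕ.>-nonZero 1≤n ⦄) (s≤s (∈ᴵ⇒≤ i∈I))

  open ConcaveClosure (_∈ᴵ? I) n 0∉ᴵ ∈ᴵ⇒<

  module Rank {n} (A : ASM n) = IsRankFunction (r-isRankFunction A)

  r-steps : (A : ASM n) → ∀ j → Steps (λ i → r A i j)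
  r-steps A j i = Rank.row-step A i j

  r-concave : (A : ASMᴵ n I) → ∀ {j} → j ∈[ n ] → Concave (λ i → r (proj₁ A) i j)
  r-concave (_ , concave) j∈ i i∈I = concave i _ i∈I j∈

  module _ {h : ℕ → ℕ → ℤ} (rank : IsRankFunction n h)
           (concave : ∀ j → j ∈[ n ] → Concave (λ i → h i j)) where
    open FromRankFunction rank

    asmᴵ : ASMᴵ n I
    asmᴵ = asm , λ i j i∈I j∈ →
      let j≤n = proj₂ j∈
          i<n = ∈ᴵ⇒< i∈I
          r≡h = λ {i} (i≤n : i ≤ n) → r-asm {i} i≤n j≤n
      in Sum.map
        (λ up → trans (r≡h (ℕₚ.<⇒≤ i<n))
          (trans up (cong (_+ 1ℤ) (sym (r≡h (ℕₚ.≤-trans (ℕₚ.m∸n≤m i 1) (ℕₚ.<⇒≤ i<n)))))))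
        (λ flat → trans (r≡h (ℕₚ.<⇒≤ i<n)) (trans flat (sym (r≡h i<n))))
        (concave j j∈ i i∈I)

    r-asmᴵ : ∀ {i j} → i ≤ n → j ≤ n → r (proj₁ asmᴵ) i j ≡ h i j
    r-asmᴵ = r-asm

  ⊓-isRankFunction : ∀ {g h} → IsRankFunction n g → IsRankFunction n h →
    IsRankFunction n (λ i j → g i j ⊓ h i j)
  ⊓-isRankFunction rg rh = record
    { row-step = λ i j → Step-⊓ (G.row-step i j) (H.row-step i j)
    ; col-step = λ i j → Step-⊓ (G.col-step i j) (H.col-step i j)
    ; top      = λ j → cong₂ _⊓_ (G.top j) (H.top j)
    ; left     = λ i≤n → cong₂ _⊓_ (G.left i≤n) (H.left i≤n)
    ; bottom   = λ j≤n → trans (cong₂ _⊓_ (G.bottom j≤n) (H.bottom j≤n)) (ℤₚ.⊓-idem _)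
    ; right    = λ i≤n → trans (cong₂ _⊓_ (G.right i≤n) (H.right i≤n)) (ℤₚ.⊓-idem _)
    }
    where
    module G = IsRankFunction rg
    module H = IsRankFunction rh

  ⊔-isRankFunction : ∀ {g h} → IsRankFunction n g → IsRankFunction n h →
    IsRankFunction n (λ i j → g i j ⊔ h i j)
  ⊔-isRankFunction rg rh = record
    { row-step = λ i j → Step-⊔ (G.row-step i j) (H.row-step i j)
    ; col-step = λ i j → Step-⊔ (G.col-step i j) (H.col-step i j)
    ; top      = λ j → cong₂ _⊔_ (G.top j) (H.top j)
    ; left     = λ i≤n → cong₂ _⊔_ (G.left i≤n) (H.left i≤n)
    ; bottom   = λ j≤n → trans (cong₂ _⊔_ (G.bottom j≤n) (H.bottom j≤n)) (ℤₚ.⊔-idem _)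
    ; right    = λ i≤n → trans (cong₂ _⊔_ (G.right i≤n) (H.right i≤n)) (ℤₚ.⊔-idem _)
    }
    where
    module G = IsRankFunction rg
    module H = IsRankFunction rh

  -- Rows `0` and `n` are outside `I`, so the closure leaves them alone. Columns `0` and `n` have
  -- constant slope 0 and 1, so they are concave already and are fixed.
  closure-isRankFunction : ∀ {h} → IsRankFunction n h →
    IsRankFunction n (λ i j → closure (λ i → h i j) i)
  closure-isRankFunction {h} rank = record
    { row-step = λ i j → closure-steps (λ i → row-step i j) i
    ; col-step = λ i j → closure-Step (λ i → col-step i j) i
    ; top      = λ j → trans (closure-∉ (λ i → h i j) 0 0∉ᴵ) (top j)
    ; left     = λ {i} i≤n → trans
                   (closure-fixed (λ i → row-step i 0)
                     (λ i i∈I → inj₂ (trans (left (ℕₚ.<⇒≤ (∈ᴵ⇒< i∈I))) (sym (left (∈ᴵ⇒< i∈I)))))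
                     i i≤n)
                   (left i≤n)
    ; bottom   = λ {j} j≤n → trans
                   (closure-∉ (λ i → h i j) n (ℕₚ.<-irrefl refl ∘ ∈ᴵ⇒<))
                   (bottom j≤n)
    ; right    = λ {i} i≤n → trans (closure-fixed (λ i → row-step i n) right-concave i i≤n) (right i≤n)
    }
    where
    open IsRankFunction rank
    right-concave : Concave (λ i → h i n)
    right-concave zero 0∈I = contradiction 0∈I 0∉ᴵ
    right-concave (suc i) i∈I = inj₁ (begin
      h (suc i) n    ≡⟨ right (ℕₚ.<⇒≤ (∈ᴵ⇒< i∈I)) ⟩
      + suc i        ≡⟨ ℤₚ.+-comm 1ℤ (+ i) ⟩
      + i + 1ℤ       ≡⟨ cong (_+ 1ℤ) (right (ℕₚ.<⇒≤ (ℕₚ.<⇒≤ (∈ᴵ⇒< i∈I)))) ⟨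
      h i n + 1ℤ     ∎)
      where open ≡-Reasoning

  module _ (A B : ASMᴵ n I) where
    private
      rA = r (proj₁ A)
      rB = r (proj₁ B)
      rank-A = r-isRankFunction (proj₁ A)
      rank-B = r-isRankFunction (proj₁ B)

    ⊓-rank : IsRankFunction n (λ i j → rA i j ⊓ rB i j)
    ⊓-rank = ⊓-isRankFunction rank-A rank-B

    ⊔-rank : IsRankFunction n (λ i j → rA i j ⊔ rB i j)
    ⊔-rank = ⊔-isRankFunction rank-A rank-B

    join-concave : ∀ j → j ∈[ n ] → Concave (λ i → rA i j ⊓ rB i j)
    join-concave j j∈ = ⊓-concave (r-steps (proj₁ A) j) (r-steps (proj₁ B) j)
                                  (r-concave A j∈) (r-concave B j∈)

    join : ASMᴵ n I
    join = asmᴵ ⊓-rank join-concave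

    r-join : ∀ {i j} → i ≤ n → j ≤ n → r (proj₁ join) i j ≡ rA i j ⊓ rB i j
    r-join = r-asmᴵ ⊓-rank join-concave

    join-isJoinᴬ : IsJoin _≤ᴬ_ (proj₁ A) (proj₁ B) (proj₁ join)
    join-isJoinᴬ =
      (λ i j (_ , i≤n) (_ , j≤n) →
        subst (_≤ᶻ rA i j) (sym (r-join i≤n j≤n)) (ℤₚ.i⊓j≤i (rA i j) (rB i j))) ,
      (λ i j (_ , i≤n) (_ , j≤n) →
        subst (_≤ᶻ rB i j) (sym (r-join i≤n j≤n)) (ℤₚ.i⊓j≤j (rA i j) (rB i j))) ,
      (λ Z A≤Z B≤Z i j i∈ j∈ →
        subst (r Z i j ≤ᶻ_) (sym (r-join (proj₂ i∈) (proj₂ j∈)))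
          (ℤₚ.⊓-glb (A≤Z i j i∈ j∈) (B≤Z i j i∈ j∈)))

    join-isJoinᴵ : IsJoin (_≤ᴵ_ {n} {I}) A B join
    join-isJoinᴵ = let A≤J , B≤J , least = join-isJoinᴬ in A≤J , B≤J , λ Z → least (proj₁ Z)

    -- The entrywise minimum `join` lies in `ASMᴵ n I`, so `J` is below it, and `join` is below
    -- every upper bound in the larger lattice.
    isJoinᴵ⇒isJoinᴬ : (J : ASMᴵ n I) → IsJoin (_≤ᴵ_ {n} {I}) A B J →
      IsJoin _≤ᴬ_ (proj₁ A) (proj₁ B) (proj₁ J)
    isJoinᴵ⇒isJoinᴬ J (A≤J , B≤J , least) =
      let A≤join , B≤join , leastᴬ = join-isJoinᴬ in
      A≤J , B≤J , λ Z A≤Z B≤Z i j i∈ j∈ →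
        ℤₚ.≤-trans (leastᴬ Z A≤Z B≤Z i j i∈ j∈) (least join A≤join B≤join i j i∈ j∈)

    -- The column index comes first: M j is a function of the row.
    M : ℕ → ℕ → ℤ
    M j i = rA i j ⊔ rB i j

    M-steps : ∀ j → Steps (M j)
    M-steps j i = IsRankFunction.row-step ⊔-rank i j

    closure-rank : IsRankFunction n (λ i j → closure (M j) i)
    closure-rank = closure-isRankFunction ⊔-rank

    meet-concave : ∀ j → j ∈[ n ] → Concave (closure (M j))
    meet-concave j _ = closure-concave (M-steps j)

    meet : ASMᴵ n I
    meet = asmᴵ closure-rank meet-concave

    r-meet : ∀ {i j} → i ≤ n → j ≤ n → r (proj₁ meet) i j ≡ closure (M j) i
    r-meet = r-asmᴵ closure-rank meet-concave

    -- The order reverses ranks, so a lower bound of `A` and `B` has columns that are concave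
    -- majorants of `M j`, and the closure is the least of these.
    meet-isMeet : IsMeet (_≤ᴵ_ {n} {I}) A B meet
    meet-isMeet =
      (λ i j (_ , i≤n) (_ , j≤n) → subst (rA i j ≤ᶻ_) (sym (r-meet i≤n j≤n))
        (ℤₚ.≤-trans (ℤₚ.i≤i⊔j (rA i j) (rB i j)) (f≤closure (M-steps j) i))) ,
      (λ i j (_ , i≤n) (_ , j≤n) → subst (rB i j ≤ᶻ_) (sym (r-meet i≤n j≤n))
        (ℤₚ.≤-trans (ℤₚ.i≤j⊔i (rA i j) (rB i j)) (f≤closure (M-steps j) i))) ,
      (λ Z Z≤A Z≤B i j (_ , i≤n) j∈ →
        subst (_≤ᶻ r (proj₁ Z) i j) (sym (r-meet i≤n (proj₂ j∈)))
          (closure-least (r-concave Z j∈) (λ where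
             -- The order compares rows from 1 on only; in row 0 both sides vanish.
             zero _ → ℤₚ.≤-reflexive
               (trans (IsRankFunction.top ⊔-rank j)
                      (sym (IsRankFunction.top (r-isRankFunction (proj₁ Z)) j)))
             i@(suc _) i≤n → ℤₚ.⊔-lub (Z≤A i j (s≤s z≤n , i≤n) j∈) (Z≤B i j (s≤s z≤n , i≤n) j∈))
           i i≤n))

    -- Two meets bound each other, which fixes the ranks in rows 1 to `n`. Row 0 is added from
    -- `top`, since the formula reads row `u t ∸ 1`, which may be 0.
    r-isMeet : (C : ASMᴵ n I) → IsMeet (_≤ᴵ_ {n} {I}) A B C →
      ∀ {i j} → i ≤ n → j ∈[ n ] → r (proj₁ C) i j ≡ closure (M j) i
    r-isMeet C _ {zero} {j} _ _ =
      trans (IsRankFunction.top (r-isRankFunction (proj₁ C)) j)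
            (sym (IsRankFunction.top closure-rank j))
    r-isMeet C (C≤A , C≤B , greatest) {i@(suc _)} {j} i≤n j∈ =
      trans (ℤₚ.≤-antisym (greatest meet meet≤A meet≤B i j i∈ j∈)
                          (proj₂ (proj₂ meet-isMeet) C C≤A C≤B i j i∈ j∈))
            (r-meet i≤n (proj₂ j∈))
      where
      i∈ = s≤s z≤n , i≤n
      meet≤A = proj₁ meet-isMeet
      meet≤B = proj₁ (proj₂ meet-isMeet)

    -- The rows `suc (v t)` and `u t ∸ 1` lie outside `I`, where the ranks of `C` agree with `M`. So
    -- `stay` and `rise`, followed to the ends of the interval, become the two terms of the minimum.
    meetFormula : ∀ {k} {u v : Fin k → ℕ} → IsIntervalDecomposition I u v →
      (C : ASMᴵ n I) → IsMeet (_≤ᴵ_ {n} {I}) A B C →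
      MeetFormula I u v (proj₁ A) (proj₁ B) (proj₁ C)
    meetFormula {u = u} {v} dec C isMeet = record
      { outside = λ i j (_ , i≤n) i∉I j∈ → trans (rC i≤n j∈) (closure-∉ (M j) i i∉I)
      ; inside  = λ t i j u≤i i≤v j∈ → begin
          r (proj₁ C) i j ≡⟨ rC (ℕₚ.<⇒≤ (∈ᴵ⇒< (interval⊆I t u≤i i≤v))) j∈ ⟩
          stay (M j) i ⊓ rise (M j) i ≡⟨ cong₂ _⊓_
            (stay-above t u≤i i≤v j∈) (rise-above t u≤i i≤v j∈) ⟩
          r (proj₁ C) (suc (v t)) j ⊓ (r (proj₁ C) (u t ∸ 1) j + (+ i - + u t + 1ℤ)) ∎
      }
      where
      open ≡-Reasoning
      open Decomposition dec
      rC : ∀ {i j} → i ≤ n → j ∈[ n ] → r (proj₁ C) i j ≡ closure (M j) i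
      rC = r-isMeet C isMeet

      stay-above : ∀ t {i j} → u t ≤ i → i ≤ v t → j ∈[ n ] →
        stay (M j) i ≡ r (proj₁ C) (suc (v t)) j
      stay-above t {i} {j} u≤i i≤v j∈ = begin
        stay (M j) i             ≡⟨ stay-interval (M j) (ℕₚ.m≤n⇒m≤1+n i≤v)
                                      (λ c i≤c c≤v → interval⊆I t (ℕₚ.≤-trans u≤i i≤c) (ℕₚ.≤-pred c≤v)) ⟩
        stay (M j) (suc (v t))   ≡⟨ stay-∉ (M j) _ (suc-v∉I t) ⟩
        M j (suc (v t))          ≡⟨ closure-∉ (M j) _ (suc-v∉I t) ⟨
        closure (M j) (suc (v t)) ≡⟨ rC (∈ᴵ⇒< (interval⊆I t (ℕₚ.≤-trans u≤i i≤v) ℕₚ.≤-refl)) j∈ ⟨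
        r (proj₁ C) (suc (v t)) j ∎

      rise-above : ∀ t {i j} → u t ≤ i → i ≤ v t → j ∈[ n ] →
        rise (M j) i ≡ r (proj₁ C) (u t ∸ 1) j + (+ i - + u t + 1ℤ)
      rise-above t {i} {j} u≤i i≤v j∈ = begin
        rise (M j) i                          ≡⟨ rise-interval (M j) (ℕₚ.≤-trans u∸1≤u u≤i)
          (λ c u≤c c≤i → interval⊆I t (subst (_≤ c) (suc[u∸1]≡u t) u≤c) (ℕₚ.≤-trans c≤i i≤v)) ⟩
        rise (M j) a + (+ i - + a)            ≡⟨ cong₂ _+_ (rise-∉ (M j) a (u∸1∉I t)) shift-i ⟩
        M j a + (+ i - + u t + 1ℤ)            ≡⟨ cong (_+ (+ i - + u t + 1ℤ)) (closure-∉ (M j) a (u∸1∉I t)) ⟨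
        closure (M j) a + (+ i - + u t + 1ℤ)  ≡⟨ cong (_+ (+ i - + u t + 1ℤ)) (rC a≤n j∈) ⟨
        r (proj₁ C) a j + (+ i - + u t + 1ℤ)  ∎
        where
        a = u t ∸ 1
        u∸1≤u = ℕₚ.m∸n≤m (u t) 1
        a≤n : a ≤ n
        a≤n = ℕₚ.≤-trans u∸1≤u (ℕₚ.≤-trans u≤i (ℕₚ.<⇒≤ (∈ᴵ⇒< (interval⊆I t u≤i i≤v))))
        shift : ∀ x y → x - y ≡ (x - (1ℤ + y)) + 1ℤ
        shift = solve-∀
        shift-i : + i - + a ≡ + i - + u t + 1ℤ
        -- The instance of `shift` contains `1ℤ + + a`, which computes to `+ suc a` and is then
        -- rewritten to `+ u t`.
        shift-i = trans (shift (+ i) (+ a)) (cong (λ w → + i - + w + 1ℤ) (suc[u∸1]≡u t))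

theorem3p6 : (n : ℕ) → 1 ≤ n →
    (I : Subset (n ∸ 1)) (k : ℕ) (u v : Fin k → ℕ) →
    IsIntervalDecomposition I u v →
    (A B : ASMᴵ n I) →
    ((∃ λ (J : ASMᴵ n I) → IsJoin (_≤ᴵ_ {n} {I}) A B J)
    × ((J : ASMᴵ n I) → IsJoin (_≤ᴵ_ {n} {I}) A B J →
    IsJoin _≤ᴬ_ (proj₁ A) (proj₁ B) (proj₁ J)))
    × ((∃ λ (C : ASMᴵ n I) → IsMeet (_≤ᴵ_ {n} {I}) A B C)
    × ((C : ASMᴵ n I) → IsMeet (_≤ᴵ_ {n} {I}) A B C →
    MeetFormula I u v (proj₁ A) (proj₁ B) (proj₁ C)))
theorem3p6 n 1≤n I k u v dec A B =
  ((join A B , join-isJoinᴵ A B) , isJoinᴵ⇒isJoinᴬ A B) ,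
  ((meet A B , meet-isMeet A B) , meetFormula A B dec)
  where open Lattice 1≤n I
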